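{- Let $G$ be a finite group. Then $G$ is an elementary abelian $2$-group if and only if the set of maximal sum-free sets in $G$ coincides with the set $\{G\setminus M : M \text{ a maximal subgroup of } G\}$ of complements of the maximal subgroups of $G$, and $\Phi(G)=1$, where $\Phi(G)$ is the Frattini subgroup of $G$ (the intersection of all maximal subgroups of $G$).
   Context: A non-empty subset $S$ of a group $G$ is called sum-free if for all $s_1,s_2\in S$ (including the case $s_1=s_2$) one has $s_1s_2\notin S$. A maximal sum-free set in a finite group $G$ means a sum-free set of largest possible cardinality among all sum-free sets in $G$ (maximal by cardinality). -}

module Defs where

open import Algebra.Bundles using (Group)
open import Data.Fin.Base using (Fin)
open import Data.Fin.Subset as Subset using (Subset; ∁; ⊤; ∣_∣)
open import Data.Nat.Base using (ℕ; _≤_)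
open import Data.Product.Base using (_×_; ∃)
open import Function.Bundles using (Inverse)
open import Level using (Level; _⊔_; suc)
open import Relation.Binary.PropositionalEquality using (_≡_; _≢_; setoid)
open import Relation.Nullary using (¬_)
open import Relation.Unary using (Pred)

record FiniteGroup (c ℓ : Level) : Set (suc (c ⊔ ℓ)) where
  field
    group       : Group c ℓ
    order       : ℕ
    enumeration : Inverse (Group.setoid group) (setoid (Fin order))

module FiniteGroupTheory {c ℓ} (G : FiniteGroup c ℓ) where

  open FiniteGroup G public
  open Group group public using (Carrier; _≈_; _∙_; ε; _⁻¹)
  open import Algebra.Definitions _≈_ using (Commutative)

  -- A subset of G is given by the set of indices of its elements under the
  -- enumeration. Inclusion, complement, cardinality and (propositional)
  -- equality of subsets are then those of Data.Fin.Subset.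
  SubsetOf : Set
  SubsetOf = Subset order

  infix 4 _∈_ _∉_

  _∈_ : Carrier → SubsetOf → Set
  x ∈ S = Inverse.to enumeration x Subset.∈ S

  _∉_ : Carrier → SubsetOf → Set
  x ∉ S = ¬ (x ∈ S)

  record IsSumFree (S : SubsetOf) : Set c where
    field
      nonempty : ∃ λ x → x ∈ S
      sumFree  : ∀ {s₁ s₂} → s₁ ∈ S → s₂ ∈ S → s₁ ∙ s₂ ∉ S

  record IsMaximalSumFree (S : SubsetOf) : Set c where
    field
      isSumFree : IsSumFree S
      largest   : ∀ {T} → IsSumFree T → ∣ T ∣ ≤ ∣ S ∣

  record IsSubgroup (H : SubsetOf) : Set c where
    field
      ε-closed  : ε ∈ H
      ∙-closed  : ∀ {x y} → x ∈ H → y ∈ H → x ∙ y ∈ H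
      ⁻¹-closed : ∀ {x} → x ∈ H → x ⁻¹ ∈ H

  record IsMaximalSubgroup (M : SubsetOf) : Set c where
    field
      isSubgroup : IsSubgroup M
      proper     : M ≢ ⊤
      maximal    : ∀ {H} → IsSubgroup H → M Subset.⊂ H → H ≡ ⊤

  IsComplementOfMaximalSubgroup : Pred SubsetOf c
  IsComplementOfMaximalSubgroup S = ∃ λ M → IsMaximalSubgroup M × S ≡ ∁ M

  -- If G has no maximal subgroups (i.e. G is trivial), this is all of G.
  Φ : Pred Carrier c
  Φ x = ∀ M → IsMaximalSubgroup M → x ∈ M

  -- The trivial group counts as an elementary abelian 2-group (of rank 0).
  record IsElementaryAbelian2Group : Set (c ⊔ ℓ) where
    field
      comm     : Commutative _∙_
      exponent : ∀ x → x ∙ x ≈ ε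

{-# OPTIONS --safe #-}
-- In an elementary abelian 2-group, left translation by an element s of a
-- sum-free set S embeds S into its complement, so ∣ S ∣ ≤ ∣ G ∣ / 2, while the
-- complement of a maximal subgroup attains this bound. If S attains it, then
-- s S is the whole complement of S, which makes that complement a subgroup.
-- Conversely, if the complement of every maximal subgroup M is sum-free, then
-- every square lies in every M, hence in Φ(G) = 1.
module Submission where

open import Defs
open import Algebra.Bundles using (AbelianGroup; module Group)
import Algebra.Properties.CommutativeSemigroup as CommutativeSemigroupProperties
import Algebra.Properties.Group as GroupProperties
open import Data.Fin.Base using (Fin; zero; suc)
open import Data.Fin.Properties using (any?; suc-injective)
open import Data.Fin.Subset as Subset
  using (Subset; _∪_; ∁; ⊤; ⁅_⁆; ∣_∣; _-_; inside; outside; _⊃_)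
open import Data.Fin.Subset.Induction using (⊃-wellFounded)
open import Data.Fin.Subset.Properties
  using ( _∈?_; ∈⊤; ⊆-antisym; ⊆⊤; x∈⁅x⁆; x∈⁅y⁆⇒x≡y; p⊆p∪q; q⊆p∪q; x∈p∪q⁻
        ; x∈p∧x≢y⇒x∈p-y; x∈p⇒∣p-x∣<∣p∣; p⊂q⇒∣p∣<∣q∣; ∣∁p∣≡n∸∣p∣
        ; x∈p⇒x∉∁p; x∈∁p⇒x∉p; x∉∁p⇒x∈p; x∉p⇒x∈∁p)
open import Data.Nat.Base using (_≤_; z≤n)
open import Data.Nat.Properties
  using ( ≤-trans; <-≤-trans; ≤-<-trans; <⇒≤; <-irrefl
        ; ≮⇒≥; ∸-monoʳ-≤; module ≤-Reasoning)
open import Data.Product.Base using (_×_; _,_; ∃; proj₁; proj₂)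
open import Data.Sum.Base using (_⊎_; inj₁; inj₂)
open import Data.Vec.Base using (_∷_; []; here; there; lookup; tabulate)
open import Data.Vec.Properties using ([]=⇒lookup; lookup⇒[]=; lookup∘tabulate)
open import Function.Base using (_∘_; case_of_)
open import Function.Bundles using (Inverse; _⇔_; mk⇔)
open import Function.Definitions using (Injective)
open import Induction.WellFounded using (Acc; acc)
open import Relation.Binary.PropositionalEquality using (_≡_; _≢_; refl; sym; trans; cong; subst)
import Relation.Binary.Reasoning.Setoid as SetoidReasoning
open import Relation.Nullary using (¬_; Dec; yes; no; contradiction; decidable-stable)
open import Relation.Nullary.Decidable using (_×-dec_; ¬?)
open import Relation.Unary using (_≐_)

-- Cardinalities of subsets of `Fin n`.

injective⇒∣p∣≤∣q∣ : ∀ {m n} {p : Subset m} {q : Subset n} {f : Fin m → Fin n} →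
                    Injective _≡_ _≡_ f → (∀ {i} → i Subset.∈ p → f i Subset.∈ q) →
                    ∣ p ∣ ≤ ∣ q ∣
injective⇒∣p∣≤∣q∣ {p = []}          inj maps = z≤n
injective⇒∣p∣≤∣q∣ {p = outside ∷ p} inj maps =
  injective⇒∣p∣≤∣q∣ (suc-injective ∘ inj) (maps ∘ there)
-- Removing `f zero` from `q` pays for the head of the vector: by injectivity the remaining elements
-- still map into `q - f zero`, so induction applies.
injective⇒∣p∣≤∣q∣ {p = inside ∷ p} {q} {f} inj maps =
  ≤-<-trans (injective⇒∣p∣≤∣q∣ {q = q - f zero} (suc-injective ∘ inj) maps′)
            (x∈p⇒∣p-x∣<∣p∣ (maps here))
  where
  maps′ : ∀ {i} → i Subset.∈ p → f (suc i) Subset.∈ q - f zero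
  maps′ i∈p = x∈p∧x≢y⇒x∈p-y (maps (there i∈p)) λ eq → case inj eq of λ ()

∣∁∣-antitone : ∀ {n} {p q : Subset n} → ∣ p ∣ ≤ ∣ q ∣ → ∣ ∁ q ∣ ≤ ∣ ∁ p ∣
∣∁∣-antitone {n} {p} {q} p≤q rewrite ∣∁p∣≡n∸∣p∣ p | ∣∁p∣≡n∸∣p∣ q = ∸-monoʳ-≤ n p≤q

-- Both sets fill at most half of `Fin n`, so `n / 2` separates the two sizes. Division is avoided
-- by contradiction: if `∁ q` were smaller than `p`, then `q` would be no larger than `p`, and
-- passing to complements closes the cycle.
∣p∣≤∣∁p∣∧∣q∣≤∣∁q∣⇒∣p∣≤∣∁q∣ : ∀ {n} {p q : Subset n} →
  ∣ p ∣ ≤ ∣ ∁ p ∣ → ∣ q ∣ ≤ ∣ ∁ q ∣ → ∣ p ∣ ≤ ∣ ∁ q ∣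
∣p∣≤∣∁p∣∧∣q∣≤∣∁q∣⇒∣p∣≤∣∁q∣ {p = p} {q} p≤∁p q≤∁q = ≮⇒≥ λ ∁q<p →
  <-irrefl refl (begin-strict
    ∣ ∁ q ∣  <⟨ ∁q<p ⟩
    ∣ p ∣    ≤⟨ p≤∁p ⟩
    ∣ ∁ p ∣  ≤⟨ ∣∁∣-antitone {p = q} {p} (≤-trans q≤∁q (<⇒≤ ∁q<p)) ⟩
    ∣ ∁ q ∣  ∎)
  where open ≤-Reasoning

p⊆q∧∣q∣≤∣p∣⇒q⊆p : ∀ {n} {p q : Subset n} → p Subset.⊆ q → ∣ q ∣ ≤ ∣ p ∣ → q Subset.⊆ p
p⊆q∧∣q∣≤∣p∣⇒q⊆p {p = p} p⊆q q≤p {x} x∈q = decidable-stable (x ∈? p) λ x∉p →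
  <-irrefl refl (<-≤-trans (p⊂q⇒∣p∣<∣q∣ (p⊆q , x , x∈q , x∉p)) q≤p)

∁-involutive : ∀ {n} (p : Subset n) → ∁ (∁ p) ≡ p
∁-involutive p = ⊆-antisym (λ x∈∁∁p → x∉∁p⇒x∈p (x∈∁p⇒x∉p x∈∁∁p))
                           (λ x∈p → x∉p⇒x∈∁p (x∈p⇒x∉∁p x∈p))

module FiniteGroupProperties {c ℓ} (G : FiniteGroup c ℓ) where

  open FiniteGroupTheory G
  open Group group
    using (assoc; ∙-congˡ; ∙-congʳ; identityˡ)
    renaming (setoid to ≈-setoid; refl to ≈-refl; sym to ≈-sym; trans to ≈-trans)
  open GroupProperties group
    using (∙-cancelˡ; inverseʳ-unique; ⁻¹-anti-homo-∙; ⁻¹-involutive; \\-leftDividesˡ)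
  open Inverse enumeration using (to; from; to-cong; from-cong; strictlyInverseˡ; strictlyInverseʳ)

  -- Subsets of a finite group and their translates.

  ∈-resp-≈ : ∀ S {x y} → x ≈ y → x ∈ S → y ∈ S
  ∈-resp-≈ S x≈y = subst (Subset._∈ S) (to-cong x≈y)

  _∈ᵍ?_ : ∀ x S → Dec (x ∈ S)
  x ∈ᵍ? S = to x ∈? S

  from-∈ : ∀ {S i} → i Subset.∈ S → from i ∈ S
  from-∈ {S} {i} = subst (Subset._∈ S) (sym (strictlyInverseˡ i))

  from-∈⁻ : ∀ {S i} → from i ∈ S → i Subset.∈ S
  from-∈⁻ {S} {i} = subst (Subset._∈ S) (strictlyInverseˡ i)

  to-injective : ∀ {x y} → to x ≡ to y → x ≈ y
  to-injective {x} {y} eq =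
    ≈-trans (≈-sym (strictlyInverseʳ x)) (≈-trans (from-cong eq) (strictlyInverseʳ y))

  ⊆-fromElements : ∀ {S T} → (∀ {x} → x ∈ S → x ∈ T) → S Subset.⊆ T
  ⊆-fromElements S⊆T i∈S = from-∈⁻ (S⊆T (from-∈ i∈S))

  translation-∣∣≤ : ∀ {S T} s → (∀ {x} → x ∈ S → s ∙ x ∈ T) → ∣ S ∣ ≤ ∣ T ∣
  translation-∣∣≤ {S} {T} s maps = injective⇒∣p∣≤∣q∣ {f = λ i → to (s ∙ from i)} inj (maps ∘ from-∈)
    where
    inj : Injective _≡_ _≡_ (λ i → to (s ∙ from i))
    inj {i} {j} eq = trans (sym (strictlyInverseˡ i))
      (trans (to-cong (∙-cancelˡ s _ _ (to-injective eq))) (strictlyInverseˡ j))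

  isSumFree⇒∣S∣≤∣∁S∣ : ∀ {S} → IsSumFree S → ∣ S ∣ ≤ ∣ ∁ S ∣
  isSumFree⇒∣S∣≤∣∁S∣ record { nonempty = s , s∈S ; sumFree = sumFree } =
    translation-∣∣≤ s λ x∈S → x∉p⇒x∈∁p (sumFree s∈S x∈S)

  infix 8 _⁻¹·_

  -- The coset x⁻¹S, as the preimage of S under left translation by x.
  _⁻¹·_ : Carrier → SubsetOf → SubsetOf
  x ⁻¹· S = tabulate λ i → lookup S (to (x ∙ from i))

  lookup-⁻¹· : ∀ x S y → lookup (x ⁻¹· S) (to y) ≡ lookup S (to (x ∙ y))
  lookup-⁻¹· x S y = trans (lookup∘tabulate _ (to y))
    (cong (lookup S) (to-cong (∙-congˡ (strictlyInverseʳ y))))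

  ∈-⁻¹·⁺ : ∀ {x S y} → x ∙ y ∈ S → y ∈ x ⁻¹· S
  ∈-⁻¹·⁺ {x} {S} {y} xy∈S = lookup⇒[]= _ _ (trans (lookup-⁻¹· x S y) ([]=⇒lookup xy∈S))

  ∈-⁻¹·⁻ : ∀ {x S y} → y ∈ x ⁻¹· S → x ∙ y ∈ S
  ∈-⁻¹·⁻ {x} {S} {y} y∈ = lookup⇒[]= _ _ (trans (sym (lookup-⁻¹· x S y)) ([]=⇒lookup y∈))

  -- Proper subsets and subgroups of index at most 2.

  proper⇒∃∉ : ∀ {S : SubsetOf} → S ≢ ⊤ → ∃ λ x → x ∉ S
  proper⇒∃∉ {S} S≢⊤ with any? (λ i → ¬? (i ∈? S))
  ... | yes (i , i∉S) = from i , i∉S ∘ from-∈⁻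
  ... | no ∄          = contradiction
    (⊆-antisym ⊆⊤ λ {i} _ → decidable-stable (i ∈? S) λ i∉S → ∄ (i , i∉S)) S≢⊤

  -- For a subgroup H, this says that H has index at most 2.
  OutsideClosed : SubsetOf → Set c
  OutsideClosed H = ∀ {x y} → x ∉ H → y ∉ H → x ∙ y ∈ H

  -- A larger subgroup `H` contains some `h` outside `M`, and then `h ⁻¹` is outside `M` too. For
  -- `y` outside `M`, the product `h ⁻¹ ∙ y` lies in `M` and so in `H`; multiplying by `h` puts `y`
  -- in `H`.
  outsideClosed⇒isMaximalSubgroup : ∀ {M x} → IsSubgroup M → x ∉ M → OutsideClosed M →
                                    IsMaximalSubgroup M
  outsideClosed⇒isMaximalSubgroup {M} {x} M≤G x∉M closed = record
    { isSubgroup = M≤G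
    ; proper     = λ { refl → x∉M ∈⊤ }
    ; maximal    = maximal
    }
    where
    maximal : ∀ {H} → IsSubgroup H → M Subset.⊂ H → H ≡ ⊤
    maximal {H} H≤G (M⊆H , i , i∈H , i∉M) = ⊆-antisym ⊆⊤ (⊆-fromElements λ {y} _ → all y)
      where
      h = from i

      h∈H : h ∈ H
      h∈H = from-∈ i∈H

      h⁻¹∉M : h ⁻¹ ∉ M
      h⁻¹∉M h⁻¹∈M = i∉M (from-∈⁻ (∈-resp-≈ M (⁻¹-involutive h) (IsSubgroup.⁻¹-closed M≤G h⁻¹∈M)))

      all : ∀ y → y ∈ H
      all y with y ∈ᵍ? M
      ... | yes y∈M = M⊆H y∈M
      ... | no  y∉M = ∈-resp-≈ H (\\-leftDividesˡ h y)
        (IsSubgroup.∙-closed H≤G h∈H (M⊆H (closed h⁻¹∉M y∉M)))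

  -- Exponent 2 from sum-free complements.

  squares≈ε⇒elementaryAbelian : (∀ x → x ∙ x ≈ ε) → IsElementaryAbelian2Group
  squares≈ε⇒elementaryAbelian x²≈ε = record { comm = comm ; exponent = x²≈ε }
    where
    open SetoidReasoning ≈-setoid

    self-inverse : ∀ x → x ≈ x ⁻¹
    self-inverse x = inverseʳ-unique x x (x²≈ε x)

    comm : ∀ x y → x ∙ y ≈ y ∙ x
    comm x y = begin
      x ∙ y        ≈⟨ self-inverse (x ∙ y) ⟩
      (x ∙ y) ⁻¹   ≈⟨ ⁻¹-anti-homo-∙ x y ⟩
      y ⁻¹ ∙ x ⁻¹  ≈⟨ ∙-congʳ (self-inverse y) ⟨
      y ∙ x ⁻¹     ≈⟨ ∙-congˡ (self-inverse x) ⟨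
      y ∙ x        ∎

  sumFreeComplements⇒elementaryAbelian :
    (∀ {M} → IsMaximalSubgroup M → IsSumFree (∁ M)) → (∀ {x} → Φ x → x ≈ ε) →
    IsElementaryAbelian2Group
  sumFreeComplements⇒elementaryAbelian ∁-sumFree Φ⊆1 = squares≈ε⇒elementaryAbelian λ x → Φ⊆1 (square∈Φ x)
    where
    square∈Φ : ∀ x → Φ (x ∙ x)
    square∈Φ x M max with x ∈ᵍ? M
    ... | yes x∈M = IsSubgroup.∙-closed (IsMaximalSubgroup.isSubgroup max) x∈M x∈M
    ... | no  x∉M = x∉∁p⇒x∈p (IsSumFree.sumFree (∁-sumFree max) (x∉p⇒x∈∁p x∉M) (x∉p⇒x∈∁p x∉M))

  -- Subgroups of an elementary abelian 2-group.

  module ElementaryAbelian (elementaryAbelian : IsElementaryAbelian2Group) where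

    open IsElementaryAbelian2Group elementaryAbelian

    abelianGroup : AbelianGroup c ℓ
    abelianGroup = record
      { isAbelianGroup = record { isGroup = Group.isGroup group ; comm = comm } }

    open CommutativeSemigroupProperties (AbelianGroup.commutativeSemigroup abelianGroup)
      using (interchange; x∙yz≈y∙xz)

    ⁻¹-trivial : ∀ x → x ≈ x ⁻¹
    ⁻¹-trivial x = inverseʳ-unique x x (exponent x)

    self-cancelˡ : ∀ x y → x ∙ (x ∙ y) ≈ y
    self-cancelˡ x y = ≈-trans (≈-sym (assoc x x y)) (≈-trans (∙-congʳ (exponent x)) (identityˡ y))

    -- Translating both factors by `s` contributes only `s ∙ s`. This turns membership facts about
    -- `s ∙ x` and `s ∙ y` into one about `x ∙ y`, as for two elements of the same coset of a
    -- subgroup.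
    translates-∙ : ∀ s x y → (s ∙ x) ∙ (s ∙ y) ≈ x ∙ y
    translates-∙ s x y =
      ≈-trans (interchange s x s y) (≈-trans (∙-congʳ (exponent s)) (identityˡ (x ∙ y)))

    -- For a subgroup `H` this is the subgroup generated by `H` and `x`: since `x` is its own
    -- inverse, two cosets suffice.
    adjoin : Carrier → SubsetOf → SubsetOf
    adjoin x H = H ∪ x ⁻¹· H

    adjoin-isSubgroup : ∀ x {H} → IsSubgroup H → IsSubgroup (adjoin x H)
    adjoin-isSubgroup x {H} H≤G = record
      { ε-closed  = inH ε-closed
      ; ∙-closed  = λ y∈ z∈ → closed (x∈p∪q⁻ H _ y∈) (x∈p∪q⁻ H _ z∈)
      ; ⁻¹-closed = λ {y} → ∈-resp-≈ (adjoin x H) (⁻¹-trivial y)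
      }
      where
      open IsSubgroup H≤G

      inH : ∀ {y} → y ∈ H → y ∈ adjoin x H
      inH = p⊆p∪q (x ⁻¹· H)

      inCoset : ∀ {y} → x ∙ y ∈ H → y ∈ adjoin x H
      inCoset xy∈H = q⊆p∪q H (x ⁻¹· H) (∈-⁻¹·⁺ xy∈H)

      closed : ∀ {y z} → y ∈ H ⊎ y ∈ x ⁻¹· H → z ∈ H ⊎ z ∈ x ⁻¹· H → y ∙ z ∈ adjoin x H
      closed         (inj₁ y∈H) (inj₁ z∈H) = inH (∙-closed y∈H z∈H)
      closed {y} {z} (inj₁ y∈H) (inj₂ z∈)  =
        inCoset (∈-resp-≈ H (x∙yz≈y∙xz y x z) (∙-closed y∈H (∈-⁻¹·⁻ z∈)))
      closed {y} {z} (inj₂ y∈)  (inj₁ z∈H) =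
        inCoset (∈-resp-≈ H (assoc x y z) (∙-closed (∈-⁻¹·⁻ y∈) z∈H))
      closed {y} {z} (inj₂ y∈)  (inj₂ z∈)  =
        inH (∈-resp-≈ H (translates-∙ x y z) (∙-closed (∈-⁻¹·⁻ y∈) (∈-⁻¹·⁻ z∈)))

    ⊂-adjoin : ∀ {x H} → IsSubgroup H → x ∉ H → H Subset.⊂ adjoin x H
    ⊂-adjoin {x} {H} H≤G x∉H = p⊆p∪q (x ⁻¹· H) , to x ,
      q⊆p∪q H (x ⁻¹· H) (∈-⁻¹·⁺ (∈-resp-≈ H (≈-sym (exponent x)) (IsSubgroup.ε-closed H≤G))) , x∉H

    -- Adjoining `x` to `M` gives a strictly larger subgroup, hence all of the group; so `y`, not
    -- being in `M`, lies in the coset `x ⁻¹· M`.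
    isMaximalSubgroup⇒outsideClosed : ∀ {M} → IsMaximalSubgroup M → OutsideClosed M
    isMaximalSubgroup⇒outsideClosed {M} max {x} {y} x∉M y∉M
      with x∈p∪q⁻ M (x ⁻¹· M) (subst (y ∈_) (sym adjoin≡⊤) ∈⊤)
      where
      open IsMaximalSubgroup max
      adjoin≡⊤ : adjoin x M ≡ ⊤
      adjoin≡⊤ = maximal (adjoin-isSubgroup x isSubgroup) (⊂-adjoin isSubgroup x∉M)
    ... | inj₁ y∈M = contradiction y∈M y∉M
    ... | inj₂ y∈  = ∈-⁻¹·⁻ y∈

    isMaximalSubgroup⇒∣M∣≤∣∁M∣ : ∀ {M} → IsMaximalSubgroup M → ∣ M ∣ ≤ ∣ ∁ M ∣
    isMaximalSubgroup⇒∣M∣≤∣∁M∣ {M} max with proper⇒∃∉ (IsMaximalSubgroup.proper max)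
    -- Translation by `x` moves `M` off itself: if `x ∙ m` were in `M`, so would be `(x ∙ m) ∙ m`,
    -- which is `x`.
    ... | x , x∉M = translation-∣∣≤ x λ {m} m∈M → x∉p⇒x∈∁p λ xm∈M →
      x∉M (∈-resp-≈ M (≈-trans (comm _ _) (≈-trans (∙-congˡ (comm x m)) (self-cancelˡ m x)))
        (∙-closed xm∈M m∈M))
      where open IsSubgroup (IsMaximalSubgroup.isSubgroup max)

    -- A subgroup M not containing x has index 2 unless some coset yM ≠ M misses x;
    -- in that case M ∪ yM is a larger subgroup not containing x.
    enlargeAvoiding : ∀ x M → Acc _⊃_ M → IsSubgroup M → x ∉ M →
                      ∃ λ N → IsMaximalSubgroup N × x ∉ N
    enlargeAvoiding x M (acc rec) M≤G x∉M
      with any? (λ i → ¬? (i ∈? M) ×-dec ¬? ((from i ∙ x) ∈ᵍ? M))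
    ... | yes (i , i∉M , yx∉M) =
      enlargeAvoiding x (adjoin y M) (rec (⊂-adjoin M≤G (i∉M ∘ from-∈⁻))) (adjoin-isSubgroup y M≤G) x∉
      where
      y = from i

      x∉ : x ∉ adjoin y M
      x∉ x∈ with x∈p∪q⁻ M _ x∈
      ... | inj₁ x∈M = x∉M x∈M
      ... | inj₂ x∈′ = yx∉M (∈-⁻¹·⁻ x∈′)
    ... | no ∄ = M , outsideClosed⇒isMaximalSubgroup M≤G x∉M closed , x∉M
      where
      open IsSubgroup M≤G

      -- The failed search says that `y ∙ x` lies in `M` for every `y` outside `M`; commutativity
      -- swaps the factors.
      x∙∈M : ∀ {y} → y ∉ M → x ∙ y ∈ M
      x∙∈M {y} y∉M = decidable-stable ((x ∙ y) ∈ᵍ? M) λ xy∉M → ∄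
        ( to y , y∉M
        , λ yx∈M → xy∉M (∈-resp-≈ M (≈-trans (∙-congʳ (strictlyInverseʳ y)) (comm y x)) yx∈M))

      closed : OutsideClosed M
      closed {y} {z} y∉M z∉M = ∈-resp-≈ M (translates-∙ x y z) (∙-closed (x∙∈M y∉M) (x∙∈M z∉M))

    -- The Frattini subgroup.

    trivialSubgroup : SubsetOf
    trivialSubgroup = ⁅ to ε ⁆

    ∈-trivial⁺ : ∀ {x} → x ≈ ε → x ∈ trivialSubgroup
    ∈-trivial⁺ x≈ε = ∈-resp-≈ trivialSubgroup (≈-sym x≈ε) (x∈⁅x⁆ (to ε))

    ∈-trivial⁻ : ∀ {x} → x ∈ trivialSubgroup → x ≈ ε
    ∈-trivial⁻ x∈ = to-injective (x∈⁅y⁆⇒x≡y (to ε) x∈)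

    trivialSubgroup-isSubgroup : IsSubgroup trivialSubgroup
    trivialSubgroup-isSubgroup = record
      { ε-closed  = ∈-trivial⁺ ≈-refl
      ; ∙-closed  = λ x∈ y∈ → ∈-trivial⁺
          (≈-trans (∙-congʳ (∈-trivial⁻ x∈)) (≈-trans (identityˡ _) (∈-trivial⁻ y∈)))
      ; ⁻¹-closed = λ {x} → ∈-resp-≈ trivialSubgroup (⁻¹-trivial x)
      }

    -- The enlargement starts from the trivial subgroup, which misses `x`. The result serves twice:
    -- it shows that `Φ` is trivial, and it supplies a maximal subgroup to compare sum-free sets
    -- with.
    maximalSubgroupAvoiding : ∀ {x} → ¬ x ≈ ε → ∃ λ M → IsMaximalSubgroup M × x ∉ M
    maximalSubgroupAvoiding {x} x≉ε = enlargeAvoiding x trivialSubgroup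
      (⊃-wellFounded trivialSubgroup) trivialSubgroup-isSubgroup (x≉ε ∘ ∈-trivial⁻)

    Φ-trivial : Φ ≐ (_≈ ε)
    Φ-trivial = Φ⊆1 , λ x≈ε M max →
      ∈-resp-≈ M (≈-sym x≈ε) (IsSubgroup.ε-closed (IsMaximalSubgroup.isSubgroup max))
      where
      Φ⊆1 : ∀ {x} → Φ x → x ≈ ε
      -- Membership in `trivialSubgroup` serves as a decision of `x ≈ ε`.
      Φ⊆1 {x} x∈Φ with x ∈ᵍ? trivialSubgroup
      ... | yes x∈ = ∈-trivial⁻ x∈
      ... | no  x∉ with maximalSubgroupAvoiding (x∉ ∘ ∈-trivial⁺)
      ...   | M , max , x∉M = contradiction (x∈Φ M max) x∉M

    -- Complements of maximal subgroups are maximal sum-free.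

    ∁-isSumFree : ∀ {M} → IsMaximalSubgroup M → IsSumFree (∁ M)
    ∁-isSumFree max = record
      { nonempty = let x , x∉M = proper⇒∃∉ (IsMaximalSubgroup.proper max) in x , x∉p⇒x∈∁p x∉M
      ; sumFree  = λ x∈ y∈ →
          x∈p⇒x∉∁p (isMaximalSubgroup⇒outsideClosed max (x∈∁p⇒x∉p x∈) (x∈∁p⇒x∉p y∈))
      }

    ∁-isMaximalSumFree : ∀ {M} → IsMaximalSubgroup M → IsMaximalSumFree (∁ M)
    ∁-isMaximalSumFree {M} max = record
      { isSumFree = ∁-isSumFree max
      ; largest   = λ {T} T-sumFree → ∣p∣≤∣∁p∣∧∣q∣≤∣∁q∣⇒∣p∣≤∣∁q∣ {p = T} {M}
          (isSumFree⇒∣S∣≤∣∁S∣ T-sumFree) (isMaximalSubgroup⇒∣M∣≤∣∁M∣ max)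
      }

    -- Maximal sum-free sets are complements of maximal subgroups.

    module _ {S} (S-max : IsMaximalSumFree S) where

      open IsMaximalSumFree S-max
      open IsSumFree isSumFree

      s = proj₁ nonempty
      s∈S = proj₂ nonempty

      ε∉S : ε ∉ S
      ε∉S ε∈S = sumFree ε∈S ε∈S (∈-resp-≈ S (≈-sym (identityˡ ε)) ε∈S)

      -- Since `s` is not the identity, some maximal subgroup `M` exists. Its complement is sum-free
      -- and fills at least half of the group, and `S` is at least as large.
      ∣∁S∣≤∣S∣ : ∣ ∁ S ∣ ≤ ∣ S ∣
      ∣∁S∣≤∣S∣ with maximalSubgroupAvoiding {s} (λ s≈ε → ε∉S (∈-resp-≈ S s≈ε s∈S))
      ... | M , max , _ = begin
        ∣ ∁ S ∣      ≤⟨ ∣∁∣-antitone {p = ∁ M} {S} ∁M≤S ⟩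
        ∣ ∁ (∁ M) ∣  ≡⟨ cong ∣_∣ (∁-involutive M) ⟩
        ∣ M ∣        ≤⟨ isMaximalSubgroup⇒∣M∣≤∣∁M∣ max ⟩
        ∣ ∁ M ∣      ≤⟨ ∁M≤S ⟩
        ∣ S ∣        ∎
        where
        open ≤-Reasoning
        ∁M≤S : ∣ ∁ M ∣ ≤ ∣ S ∣
        ∁M≤S = largest (∁-isSumFree max)

      -- ∁ S and its subset s S have the same size.
      translate-∉ : ∀ {x} → x ∉ S → s ∙ x ∈ S
      translate-∉ x∉S = ∈-⁻¹·⁻ (p⊆q∧∣q∣≤∣p∣⇒q⊆p sS⊆∁S ∣∁S∣≤∣sS∣ (x∉p⇒x∈∁p x∉S))
        where
        sS⊆∁S : s ⁻¹· S Subset.⊆ ∁ S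
        sS⊆∁S = ⊆-fromElements λ x∈ → x∉p⇒x∈∁p λ x∈S → sumFree s∈S x∈S (∈-⁻¹·⁻ x∈)

        ∣∁S∣≤∣sS∣ : ∣ ∁ S ∣ ≤ ∣ s ⁻¹· S ∣
        ∣∁S∣≤∣sS∣ = ≤-trans ∣∁S∣≤∣S∣ (translation-∣∣≤ s λ {x} x∈S →
          ∈-⁻¹·⁺ (∈-resp-≈ S (≈-sym (self-cancelˡ s x)) x∈S))

      -- For `x` and `y` outside `S`, both `s ∙ x` and `s ∙ y` lie in `S`, so sum-freeness keeps
      -- their product, which is `x ∙ y`, out of `S`.
      ∁S-isSubgroup : IsSubgroup (∁ S)
      ∁S-isSubgroup = record
        { ε-closed  = x∉p⇒x∈∁p ε∉S
        ; ∙-closed  = λ {x} {y} x∈ y∈ → x∉p⇒x∈∁p λ xy∈S →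
            sumFree (translate-∉ (x∈∁p⇒x∉p x∈)) (translate-∉ (x∈∁p⇒x∉p y∈))
              (∈-resp-≈ S (≈-sym (translates-∙ s x y)) xy∈S)
        ; ⁻¹-closed = λ {x} → ∈-resp-≈ (∁ S) (⁻¹-trivial x)
        }

      -- Sum-freeness of `S` is exactly `OutsideClosed` for the subgroup `∁ S`, and `s` witnesses
      -- that this subgroup is proper.
      isMaximalSumFree⇒isComplement : IsComplementOfMaximalSubgroup S
      isMaximalSumFree⇒isComplement = ∁ S
        , outsideClosed⇒isMaximalSubgroup ∁S-isSubgroup (x∈p⇒x∉∁p s∈S)
            (λ x∉ y∉ → x∉p⇒x∈∁p (sumFree (x∉∁p⇒x∈p x∉) (x∉∁p⇒x∈p y∉)))
        , sym (∁-involutive S)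

    maximalSumFree≐complements : IsMaximalSumFree ≐ IsComplementOfMaximalSubgroup
    maximalSumFree≐complements = (λ S-max → isMaximalSumFree⇒isComplement S-max) ,
      λ { (M , max , refl) → ∁-isMaximalSumFree max }

theorem2 : ∀ {c ℓ} (G : FiniteGroup c ℓ) → let open FiniteGroupTheory G in
    IsElementaryAbelian2Group ⇔
    ((IsMaximalSumFree ≐ IsComplementOfMaximalSubgroup) × (Φ ≐ (_≈ ε)))
theorem2 G = mk⇔
  (λ elementaryAbelian → let open ElementaryAbelian elementaryAbelian in
    maximalSumFree≐complements , Φ-trivial)
  (λ { ((_ , complement⇒maximal) , (Φ⊆1 , _)) → sumFreeComplements⇒elementaryAbelian
    (λ max → IsMaximalSumFree.isSumFree (complement⇒maximal (_ , max , refl))) Φ⊆1 })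
  where
  open FiniteGroupTheory G
  open FiniteGroupProperties G
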